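{- Let $n \geq 1$ and $0 \leq m \leq n$ be integers, and let $\mathbf{t} = (t_1, t_2, \ldots, t_m) \in [n]^m$ be an increasing list (i.e. $t_1 < t_2 < \cdots < t_m$). Let $\mathbf{u} = (u_1, u_2, \ldots, u_{n-m})$ be the increasing rearrangement of $[n] \setminus \{t_1, \ldots, t_m\}$, and let $\mathbf{x} = (u_1, u_2 - u_1, u_3 - u_2, \ldots, u_{n-m} - u_{n-m-1})$. Then $|\operatorname{PC}_n(\mathbf{t})| = P_{n-m}(\mathbf{x})$.
   Context: Write $[n] = \{1, 2, \ldots, n\}$. Parking functions: on a one-way street there are $n$ spots numbered $1, \ldots, n$ in order. Given a preference list $\mathbf{a} = (a_1, \ldots, a_n) \in [n]^n$, cars $1, 2, \ldots, n$ enter in this order; car $i$ parks in the first available spot numbered at least $a_i$, if one exists. The list $\mathbf{a}$ is a parking function of length $n$ if all cars can park. Equivalently (a standard fact), the weakly increasing rearrangement $\mathbf{a}^\uparrow$ of $\mathbf{a}$ satisfies $a_i^\uparrow \leq i$ for all $i \in [n]$. The set of parking functions of length $n$ is denoted $\operatorname{PF}_n$. Parking completions: for a fixed increasing list $\mathbf{t} = (t_1, \ldots, t_m) \in [n]^m$ (spots already taken, so the $t_j$ are distinct), a sequence $\mathbf{c} = (c_1, \ldots, c_{n-m}) \in [n]^{n-m}$ is a parking completion for $\mathbf{t}$ if the concatenation $(t_1, \ldots, t_m, c_1, \ldots, c_{n-m})$ is a parking function of length $n$. The set of all parking completions for $\mathbf{t}$ is denoted $\operatorname{PC}_n(\mathbf{t})$.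 For $\mathbf{x} = (x_1, \ldots, x_N)$, define $$P_N(\mathbf{x}) = \sum_{(a_1, \ldots, a_N) \in \operatorname{PF}_N} x_{a_1} x_{a_2} \cdots x_{a_N},$$ where the sum is over (classical) parking functions of length $N$ (with $P_0 = 1$ for the empty vector). -}

module Defs where

open import Data.Fin.Base using (Fin; toℕ) renaming (_≤_ to _≤ᶠ_; _<_ to _<ᶠ_)
open import Data.Fin.Properties using () renaming (_≤?_ to _≤ᶠ?_)
open import Data.Fin.Subset using (Subset; ⊥; _∪_; ⁅_⁆)
open import Data.Fin.Subset.Properties using (_∈?_)
open import Data.List.Base as List using (List; []; _∷_; allFin; cartesianProductWith; filter; find)
open import Data.List.Membership.Propositional using (_∈_)
open import Data.List.Membership.Propositional.Properties using (∈-allFin; ∈-cartesianProductWith⁺)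
import Data.List.Relation.Unary.All as All
open import Data.List.Relation.Unary.Any using (here)
open import Data.List.Relation.Unary.Unique.Propositional using (Unique; []; _∷_)
open import Data.List.Relation.Unary.Unique.Propositional.Properties using (allFin⁺; cartesianProductWith⁺)
open import Data.Maybe.Base using (Maybe; just; _>>=_)
open import Data.Maybe using (Is-just)
import Data.Maybe.Relation.Unary.Any as Any
open import Data.Nat.Base using (ℕ; zero; suc; _∸_; _≤_)
open import Data.Nat.ListAction using (product; sum)
open import Data.Nat.Properties using (m+[n∸m]≡n)
open import Data.Unit.Base using (tt)
open import Data.Vec.Base as Vec using (Vec; []; _∷_; _++_; cast; lookup; map; toList)
open import Data.Vec.Membership.Propositional using () renaming (_∈_ to _∈ᵛ_; _∉_ to _∉ᵛ_)
open import Data.Vec.Properties using (∷-injective)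
open import Data.Vec.Relation.Unary.Linked using (Linked)
open import Data.Product.Base using (_×_)
open import Function.Bundles using (_⇔_)
open import Relation.Binary.PropositionalEquality using (refl)
open import Relation.Nullary.Decidable using (yes; _×-dec_; ¬?)
open import Relation.Unary using (Decidable)

private
  variable
    n m k : ℕ

-- The set [n] = {1, …, n} is represented by Fin n; i : Fin n stands for the
-- number suc (toℕ i).

number : Fin n → ℕ
number i = suc (toℕ i)

-- A car with preference a meets the spots in the order of allFin n, which is
-- increasing, so find returns the smallest spot that is at least a and free.

firstAvailable : Subset n → Fin n → Maybe (Fin n)
firstAvailable {n} occupied a =
  find (λ s → (a ≤ᶠ? s) ×-dec ¬? (s ∈? occupied)) (allFin n)

-- The spots occupied after all cars have parked, or nothing as soon as some
-- car fails to park.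

parkAll : Subset n → Vec (Fin n) k → Maybe (Subset n)
parkAll occupied []       = just occupied
parkAll occupied (a ∷ as) =
  firstAvailable occupied a >>= λ s → parkAll (occupied ∪ ⁅ s ⁆) as

ParkingFunction : Vec (Fin n) n → Set
ParkingFunction a = Is-just (parkAll ⊥ a)

parkingFunction? : Decidable (ParkingFunction {n})
parkingFunction? a = Any.dec (λ _ → yes tt) (parkAll ⊥ a)

ParkingCompletion : m ≤ n → Vec (Fin n) m → Vec (Fin n) (n ∸ m) → Set
ParkingCompletion m≤n t c = ParkingFunction (cast (m+[n∸m]≡n m≤n) (t ++ c))

parkingCompletion? : (m≤n : m ≤ n) (t : Vec (Fin n) m) →
                     Decidable (ParkingCompletion m≤n t)
parkingCompletion? m≤n t c = parkingFunction? (cast (m+[n∸m]≡n m≤n) (t ++ c))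

-- All of [n]^k, each element exactly once (see ∈-words and words-unique).

words : ∀ n k → List (Vec (Fin n) k)
words n zero    = [] ∷ []
words n (suc k) = cartesianProductWith _∷_ (allFin n) (words n k)

∈-words : (w : Vec (Fin n) k) → w ∈ words n k
∈-words []      = here refl
∈-words (i ∷ w) = ∈-cartesianProductWith⁺ _∷_ (∈-allFin i) (∈-words w)

words-unique : ∀ n k → Unique (words n k)
words-unique n zero    = All.[] ∷ []
words-unique n (suc k) =
  cartesianProductWith⁺ _∷_ ∷-injective (allFin⁺ n) (words-unique n k)

PF : ∀ n → List (Vec (Fin n) n)
PF n = filter parkingFunction? (words n n)

PC : m ≤ n → Vec (Fin n) m → List (Vec (Fin n) (n ∸ m))
PC {m} {n} m≤n t = filter (parkingCompletion? m≤n t) (words n (n ∸ m))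

P : ∀ N → Vec ℕ N → ℕ
P N x = sum (List.map (λ a → product (toList (map (lookup x) a))) (PF N))

Increasing : Vec (Fin n) k → Set
Increasing = Linked _<ᶠ_

IncreasingComplement : Vec (Fin n) m → Vec (Fin n) k → Set
IncreasingComplement t u = Increasing u × (∀ i → i ∈ᵛ u ⇔ i ∉ᵛ t)

differencesFrom : ℕ → Vec ℕ k → Vec ℕ k
differencesFrom p []       = []
differencesFrom p (v ∷ vs) = v ∸ p ∷ differencesFrom v vs

-- differences (u₁, …, u_k) = (u₁, u₂ − u₁, …, u_k − u_{k−1}).  Truncated
-- subtraction is exact when u is increasing; the first entry is u₁ − 0.

differences : Vec (Fin n) k → Vec ℕ k
differences u = differencesFrom 0 (map number u)

{-# OPTIONS --safe #-}
-- Once the cars t have parked, the free spots are u₁ < … < u_k, and a car with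
-- preference i ∈ (u_{j−1}, u_j] behaves on [n] exactly as a car with preference
-- j behaves on the street [k] formed by the free spots; a car with preference
-- above u_k fails.  Hence c is a completion iff the word of its blocks is a
-- parking function of length k, and the word (a₁, …, a_k) arises from
-- x_{a₁} ⋯ x_{a_k} lists c.
module Submission where

open import Defs
open import Data.Bool.Base using (true; false; if_then_else_)
open import Data.Fin.Base using (Fin; zero; suc; toℕ) renaming (_≤_ to _≤ᶠ_)
import Data.Fin.Properties as Fin
open import Data.Fin.Subset using (Subset; ⊥; _∪_; ⁅_⁆; _∉_)
open import Data.Fin.Subset.Properties
  using (_∈?_; ∉⊥; x∈p∪q⁺; x∈p∪q⁻; x∈⁅x⁆; x∈⁅y⁆⇒x≡y)
open import Data.List.Base as List
  using (List; []; _∷_; _++_; allFin; applyUpTo; cartesianProductWith; filter;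
         find; length; tabulate)
open import Data.List.Properties
  using (applyUpTo-∷ʳ; filter-++; filter-none; filter-≐; map-++; map-∘; map-tabulate; tabulate-cong)
open import Data.Maybe.Base as Maybe using (Maybe; just; nothing; maybe; _>>=_)
open import Data.Maybe using (Is-just)
import Data.List.Relation.Unary.All as Allˡ
import Data.Maybe.Properties as Maybe
import Data.Maybe.Relation.Unary.Any as Any
open import Data.Nat.Base
  using (ℕ; zero; suc; _+_; _*_; _∸_; _≤_; _<_; z≤n; s≤s; s≤s⁻¹)
open import Data.Nat.ListAction using (product; sum)
open import Data.Nat.ListAction.Properties using (sum-++)
open import Data.Nat.Properties
  using (_<?_; ≤-refl; ≤-trans; <-trans; <⇒≤; <⇒≱; <-≤-trans; m≤n⇒m≤1+n; m≤n⇒m<n∨m≡n;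
         n∸n≡0; +-∸-assoc; +-identityʳ; +-assoc; +-comm; *-zeroʳ;
         *-distribˡ-+; *-identityˡ; m+[n∸m]≡n)
open import Data.Product.Base using (∃; _×_; _,_; proj₁; proj₂)
open import Data.Sum.Base using (inj₁; inj₂; [_,_]′)
open import Data.Unit.Base using (tt)
open import Data.Vec.Base as Vec
  using (Vec; []; _∷_; cast; lookup; replicate; toList)
open import Data.Vec.Membership.Propositional
  using () renaming (_∉_ to _∉ᵛ_)
open import Data.Vec.Membership.Propositional.Properties using (∈-lookup)
open import Data.Vec.Properties using (lookup-map; lookup-replicate)
open import Data.Vec.Relation.Unary.All as All using (All; []; _∷_)
import Data.Vec.Relation.Unary.All.Properties as All
open import Data.Vec.Relation.Unary.Any as Anyᵛ using (here; there)
open import Data.Vec.Relation.Unary.Any.Properties using (lookup-index)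
open import Data.Vec.Relation.Unary.Linked as Linked using (Linked; [-]; _∷_)
import Data.Vec.Relation.Unary.Linked.Properties as Linked
open import Level using (0ℓ)
open import Function.Base using (_∘_; id)
open import Function.Bundles using (Equivalence)
open import Relation.Binary.Core using (Rel)
open import Relation.Binary.Definitions using (Transitive; tri<; tri≈; tri>)
open import Relation.Binary.PropositionalEquality
open import Relation.Nullary.Decidable
  using (does; yes; no; dec-true; dec-false; _×-dec_; ¬?)
open import Relation.Nullary.Negation using (¬_; contradiction)
open import Relation.Unary using (Decidable; Pred)

private
  variable
    n m k l p : ℕ
    A : Set

Linked-∷⇒All : {R : Rel A 0ℓ} → Transitive R → {x : A} {xs : Vec A n} →
               Linked R (x ∷ xs) → All (R x) xs
Linked-∷⇒All trans [-]         = []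
Linked-∷⇒All trans (Rxy ∷ Rys) = Linked.Linked⇒All trans Rxy Rys

-- Least elements, and the first available spot as one.

least : {Q : Pred (Fin n) 0ℓ} → Decidable Q → Maybe (Fin n)
least {n = zero}  Q? = nothing
least {n = suc n} Q? =
  if does (Q? zero) then just zero else Maybe.map suc (least (Q? ∘ suc))

data IsLeast (Q : Pred (Fin n) 0ℓ) : Maybe (Fin n) → Set where
  none : (∀ i → ¬ Q i) → IsLeast Q nothing
  some : ∀ {i} → Q i → (∀ j → Q j → i ≤ᶠ j) → IsLeast Q (just i)

isLeast-least : {Q : Pred (Fin n) 0ℓ} (Q? : Decidable Q) → IsLeast Q (least Q?)
isLeast-least {n = zero}  Q? = none λ ()
isLeast-least {n = suc n} Q? with Q? zero
... | yes q₀ = some q₀ λ _ _ → z≤n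
... | no ¬q₀ with least (Q? ∘ suc) | isLeast-least (Q? ∘ suc)
...   | nothing | none ¬q   = none λ { zero → ¬q₀ ; (suc i) → ¬q i }
...   | just i  | some q i≤ =
  some q λ { zero q₀ → contradiction q₀ ¬q₀ ; (suc j) qⱼ → s≤s (i≤ j qⱼ) }

-- Two searches can thus be compared by checking that both results meet one specification, without
-- tracing either search.
isLeast-unique : {Q : Pred (Fin n) 0ℓ} {r s : Maybe (Fin n)} →
                 IsLeast Q r → IsLeast Q s → r ≡ s
isLeast-unique (none _)    (none _)    = refl
isLeast-unique (none ¬q)   (some q _)  = contradiction q (¬q _)
isLeast-unique (some q _)  (none ¬q)   = contradiction q (¬q _)
isLeast-unique (some q i≤) (some r j≤) = cong just (Fin.≤-antisym (i≤ _ r) (j≤ _ q))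

-- The function `f` is arbitrary because the induction replaces it by `f ∘ suc`; `allFin n` is the
-- case `f = id`.
find-tabulate : {Q : Pred A 0ℓ} (Q? : Decidable Q) (f : Fin n → A) →
                find Q? (tabulate f) ≡ Maybe.map f (least (Q? ∘ f))
find-tabulate {n = zero}  Q? f = refl
find-tabulate {n = suc n} Q? f with does (Q? (f zero))
... | true  = refl
... | false =
  trans (find-tabulate Q? (f ∘ suc)) (Maybe.map-∘ (least (Q? ∘ f ∘ suc)))

Available : Subset n → Fin n → Pred (Fin n) 0ℓ
Available O a s = a ≤ᶠ s × s ∉ O

isLeast-firstAvailable : (O : Subset n) (a : Fin n) →
                         IsLeast (Available O a) (firstAvailable O a)
isLeast-firstAvailable O a =
  subst (IsLeast _) (sym (trans (find-tabulate available? id) (Maybe.map-id _)))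
        (isLeast-least available?)
  where
  available? : Decidable (Available O a)
  available? s = (a Fin.≤? s) ×-dec ¬? (s ∈? O)

-- Weighted counts of words that park, by recursion on the first car.

parks? : (O : Subset n) → Decidable (λ (a : Vec (Fin n) k) → Is-just (parkAll O a))
parks? O a = Any.dec (λ _ → yes tt) (parkAll O a)

weight : Vec ℕ n → Vec (Fin n) k → ℕ
weight x a = product (toList (Vec.map (lookup x) a))

-- P k x is the case O = ⊥ and l = k.
parkingWeight : Vec ℕ n → Subset n → ℕ → ℕ
parkingWeight {n} x O l = sum (List.map (weight x) (filter (parks? O) (words n l)))

sum-map-*ˡ : (c : ℕ) (f : A → ℕ) (as : List A) →
             sum (List.map (λ a → c * f a) as) ≡ c * sum (List.map f as)
sum-map-*ˡ c f []       = sym (*-zeroʳ c)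
sum-map-*ˡ c f (a ∷ as) =
  trans (cong (c * f a +_) (sum-map-*ˡ c f as)) (sym (*-distribˡ-+ c (f a) _))

filter-map : {B : Set} {Q : Pred B 0ℓ} (Q? : Decidable Q) (f : A → B) (as : List A) →
             filter Q? (List.map f as) ≡ List.map f (filter (Q? ∘ f) as)
filter-map Q? f []       = refl
filter-map Q? f (a ∷ as) with does (Q? (f a))
... | true  = cong (f a ∷_) (filter-map Q? f as)
... | false = filter-map Q? f as

afterFirst : Vec ℕ n → Subset n → ℕ → Maybe (Fin n) → ℕ
afterFirst x O l = maybe (λ s → parkingWeight x (O ∪ ⁅ s ⁆) l) 0

-- Group the words by their first letter `i`: the factor x_i comes out, and the remaining letters
-- must park once the first car has taken its spot. Both sides of the theorem are unfolded by this
-- recursion.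
parkingWeight-suc : (x : Vec ℕ n) (O : Subset n) (l : ℕ) →
  parkingWeight x O (suc l) ≡
  sum (tabulate λ i → lookup x i * afterFirst x O l (firstAvailable O i))
parkingWeight-suc {n} x O l =
  trans (go (allFin n)) (cong sum (map-tabulate {n = n} id
      λ i → lookup x i * afterFirst x O l (firstAvailable O i)))
  where
  open ≡-Reasoning

  ws : List (Vec (Fin n) l)
  ws = words n l

  total : List (Vec (Fin n) k) → ℕ
  total = sum ∘ List.map (weight x)

  -- `parks? O (i ∷ a)` unfolds to this test at `r = firstAvailable O i`; with `r` a variable, it
  -- can be split into cases.
  rest? : (r : Maybe (Fin n)) →
          Decidable (λ (a : Vec (Fin n) l) → Is-just (r >>= λ s → parkAll (O ∪ ⁅ s ⁆) a))
  rest? r a = Any.dec (λ _ → yes tt) (r >>= λ s → parkAll (O ∪ ⁅ s ⁆) a)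

  total-rest : ∀ r → total (filter (rest? r) ws) ≡ afterFirst x O l r
  total-rest (just s) = refl
  -- After a failed first car no continuation parks, which accounts for the default 0 in
  -- `afterFirst`.
  total-rest nothing  =
    cong total (filter-none (rest? nothing) (Allˡ.universal (λ _ ()) ws))

  total-∷ : ∀ i → total (filter (parks? O) (List.map (i ∷_) ws)) ≡
                  lookup x i * afterFirst x O l (firstAvailable O i)
  total-∷ i = begin
    total (filter (parks? O) (List.map (i ∷_) ws))
      ≡⟨ cong total (filter-map (parks? O) (i ∷_) ws) ⟩
    total (List.map (i ∷_) (filter (rest? (firstAvailable O i)) ws))
      ≡⟨ cong sum (map-∘ (filter (rest? (firstAvailable O i)) ws)) ⟨
    sum (List.map (λ a → lookup x i * weight x a) (filter (rest? (firstAvailable O i)) ws))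
      ≡⟨ sum-map-*ˡ (lookup x i) (weight x) (filter (rest? (firstAvailable O i)) ws) ⟩
    lookup x i * total (filter (rest? (firstAvailable O i)) ws)
      ≡⟨ cong (lookup x i *_) (total-rest (firstAvailable O i)) ⟩
    lookup x i * afterFirst x O l (firstAvailable O i) ∎

  go : ∀ is → total (filter (parks? O) (cartesianProductWith _∷_ is ws)) ≡
              sum (List.map (λ i → lookup x i * afterFirst x O l (firstAvailable O i)) is)
  go []       = refl
  go (i ∷ is) = begin
    total (filter (parks? O) (List.map (i ∷_) ws ++ cs))
      ≡⟨ cong total (filter-++ (parks? O) (List.map (i ∷_) ws) cs) ⟩
    total (filter (parks? O) (List.map (i ∷_) ws) ++ filter (parks? O) cs)
      ≡⟨ cong sum (map-++ (weight x) (filter (parks? O) (List.map (i ∷_) ws)) _) ⟩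
    sum (List.map (weight x) (filter (parks? O) (List.map (i ∷_) ws)) ++
         List.map (weight x) (filter (parks? O) cs))
      ≡⟨ sum-++ (List.map (weight x) (filter (parks? O) (List.map (i ∷_) ws))) _ ⟩
    total (filter (parks? O) (List.map (i ∷_) ws)) + total (filter (parks? O) cs)
      ≡⟨ cong₂ _+_ (total-∷ i) (go is) ⟩
    _ ∎
    where
    cs = cartesianProductWith _∷_ is ws

weight-ones : (a : Vec (Fin n) k) → weight (replicate n 1) a ≡ 1
weight-ones []      = refl
weight-ones (i ∷ a) = cong₂ _*_ (lookup-replicate i 1) (weight-ones a)

-- Counting is weighing with all variables equal to 1, so the number of completions obeys the same
-- recursion as `P`.
length≡parkingWeight : (O : Subset n) (k : ℕ) →
  length (filter (parks? O) (words n k)) ≡ parkingWeight (replicate n 1) O k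
length≡parkingWeight {n} O k = go (filter (parks? O) (words n k))
  where
  go : (as : List (Vec (Fin n) k)) →
       length as ≡ sum (List.map (weight (replicate n 1)) as)
  go []       = refl
  go (a ∷ as) = cong₂ _+_ (sym (weight-ones a)) (go as)

-- Sums over [n] split into blocks.

-- The index j of the block (v_{j−1}, v_j] that contains the number suc i.
block : Vec ℕ k → ℕ → Maybe (Fin k)
block v i = least λ j → i <? lookup v j

block-< : ∀ {w} (v : Vec ℕ k) {i} → i < w → block (w ∷ v) i ≡ just zero
block-< {w = w} v {i} i<w rewrite dec-true (i <? w) i<w = refl

block-≥ : ∀ {w} (v : Vec ℕ k) {i} → w ≤ i →
          block (w ∷ v) i ≡ Maybe.map suc (block v i)
block-≥ {w = w} v {i} w≤i rewrite dec-false (i <? w) (λ i<w → <⇒≱ i<w w≤i) = refl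

sumBelow : (ℕ → ℕ) → ℕ → ℕ
sumBelow f n = sum (applyUpTo f n)

sumBelow-suc : (f : ℕ → ℕ) (n : ℕ) → sumBelow f (suc n) ≡ sumBelow f n + f n
sumBelow-suc f n = begin
  sum (applyUpTo f (suc n))           ≡⟨ cong sum (applyUpTo-∷ʳ f n) ⟨
  sum (applyUpTo f n List.∷ʳ f n)     ≡⟨ sum-++ (applyUpTo f n) _ ⟩
  sumBelow f n + (f n + 0)            ≡⟨ cong (sumBelow f n +_) (+-identityʳ (f n)) ⟩
  sumBelow f n + f n                  ∎
  where open ≡-Reasoning

-- The indices p ≤ i < q stand for the numbers in the block (p, q]; their count `q ∸ p` is where the
-- differences of u come from.
sumBelow-constant : ∀ (f : ℕ → ℕ) {c p} q → p ≤ q →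
  (∀ i → p ≤ i → i < q → f i ≡ c) → sumBelow f q ≡ sumBelow f p + (q ∸ p) * c
sumBelow-constant f zero    z≤n _ = refl
sumBelow-constant f {c} {p} (suc q) p≤1+q f≡c with m≤n⇒m<n∨m≡n p≤1+q
... | inj₂ refl rewrite n∸n≡0 q = sym (+-identityʳ _)
... | inj₁ (s≤s p≤q) = begin
  sumBelow f (suc q)                   ≡⟨ sumBelow-suc f q ⟩
  sumBelow f q + f q                   ≡⟨ cong₂ _+_ ih (f≡c q p≤q ≤-refl) ⟩
  sumBelow f p + (q ∸ p) * c + c       ≡⟨ +-assoc (sumBelow f p) _ c ⟩
  sumBelow f p + ((q ∸ p) * c + c)     ≡⟨ cong (sumBelow f p +_) (+-comm _ c) ⟩
  sumBelow f p + suc (q ∸ p) * c       ≡⟨ cong (λ d → sumBelow f p + d * c) (+-∸-assoc 1 p≤q) ⟨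
  sumBelow f p + (suc q ∸ p) * c       ∎
  where
  open ≡-Reasoning
  ih = sumBelow-constant f q p≤q λ i p≤i i<q → f≡c i p≤i (m≤n⇒m≤1+n i<q)

-- Induction on `v`, peeling off the first block: the indices from `p` to below `w` give `w ∸ p`
-- copies of `G (just zero)`, and the rest starts at `w` with block indices shifted by `suc`.
-- Indices past the last entry of `v` lie in no block and contribute `G nothing`, which is 0. The
-- terms below `p` are carried along so that the induction can move `p`.
sumBelow-blocks :
  (f : ℕ → ℕ) (G : Maybe (Fin k) → ℕ) → G nothing ≡ 0 →
  (v : Vec ℕ k) → Linked _<_ v → All (p ≤_) v → All (_≤ n) v → p ≤ n →
  (∀ i → p ≤ i → i < n → f i ≡ G (block v i)) →
  sumBelow f n ≡
  sumBelow f p + sum (tabulate λ j → lookup (differencesFrom p v) j * G (just j))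
sumBelow-blocks {p = p} {n = n} f G G≡0 [] _ _ _ p≤n f≡G = trans
  (sumBelow-constant f n p≤n (λ i p≤i i<n → trans (f≡G i p≤i i<n) G≡0))
  (cong (sumBelow f p +_) (*-zeroʳ (n ∸ p)))
sumBelow-blocks {p = p} {n = n} f G G≡0 (w ∷ v) v↑ (p≤w ∷ _) (w≤n ∷ v≤n) p≤n f≡G = begin
  sumBelow f n
    ≡⟨ sumBelow-blocks f (G ∘ Maybe.map suc) G≡0 v (Linked.tail v↑)
         (All.map <⇒≤ (Linked-∷⇒All <-trans v↑)) v≤n w≤n
         (λ i w≤i i<n → trans (f≡G i (≤-trans p≤w w≤i) i<n) (cong G (block-≥ v w≤i))) ⟩
  sumBelow f w + Σ
    ≡⟨ cong (_+ Σ) (sumBelow-constant f w p≤w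
         λ i p≤i i<w → trans (f≡G i p≤i (<-≤-trans i<w w≤n)) (cong G (block-< v i<w))) ⟩
  sumBelow f p + (w ∸ p) * G (just zero) + Σ
    ≡⟨ +-assoc (sumBelow f p) _ Σ ⟩
  sumBelow f p + ((w ∸ p) * G (just zero) + Σ) ∎
  where
  open ≡-Reasoning
  Σ = sum (tabulate λ j → lookup (differencesFrom w v) j * G (just (suc j)))

tabulate-toℕ : (f : ℕ → A) (n : ℕ) → tabulate {n = n} (f ∘ toℕ) ≡ applyUpTo f n
tabulate-toℕ f zero    = refl
tabulate-toℕ f (suc n) = cong (f 0 ∷_) (tabulate-toℕ (f ∘ suc) n)

-- Parking on [n] simulated on the street of free spots.

∉-∪⁅⁆⁺ : {O : Subset n} {r s : Fin n} → s ∉ O → s ≢ r → s ∉ O ∪ ⁅ r ⁆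
∉-∪⁅⁆⁺ {O = O} s∉O s≢r s∈ = [ s∉O , s≢r ∘ x∈⁅y⁆⇒x≡y _ ]′ (x∈p∪q⁻ O _ s∈)

∉-∪⁅⁆⁻ : {O : Subset n} {r s : Fin n} → s ∉ O ∪ ⁅ r ⁆ → s ∉ O × s ≢ r
∉-∪⁅⁆⁻ s∉ = (s∉ ∘ x∈p∪q⁺ ∘ inj₁) , λ { refl → s∉ (x∈p∪q⁺ (inj₂ (x∈⁅x⁆ _))) }

lookup-mono-≤ : {u : Vec (Fin n) k} → Increasing u →
                ∀ {i j} → i ≤ᶠ j → lookup u i ≤ᶠ lookup u j
lookup-mono-≤ u↑ {i} {j} i≤j with Fin.<-cmp i j
... | tri< i<j _ _  = <⇒≤ (Linked.lookup⁺ <-trans u↑ i<j)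
... | tri≈ _ refl _ = ≤-refl
... | tri> _ _ j<i  = contradiction i≤j (<⇒≱ j<i)

lookup-injective : {u : Vec (Fin n) k} → Increasing u →
                   ∀ {i j} → lookup u i ≡ lookup u j → i ≡ j
lookup-injective u↑ {i} {j} eq with Fin.<-cmp i j
... | tri< i<j _ _  = contradiction eq (Fin.<⇒≢ (Linked.lookup⁺ <-trans u↑ i<j))
... | tri≈ _ i≡j _  = i≡j
... | tri> _ _ j<i  = contradiction (sym eq) (Fin.<⇒≢ (Linked.lookup⁺ <-trans u↑ j<i))

-- The invariant of the simulation: the spots free on [n] are exactly the u_j with `j` free on the
-- short street.
record FreeSpots (u : Vec (Fin n) k) (occ : Subset n) (O : Subset k) : Set where
  field
    index : ∀ {s} → s ∉ occ → ∃ λ j → lookup u j ≡ s × j ∉ O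
    free  : ∀ {j} → j ∉ O → lookup u j ∉ occ

-- Since u is injective, filling u_j removes no free index other than `j`.
FreeSpots-∪ : {u : Vec (Fin n) k} → Increasing u → ∀ {occ O} → FreeSpots u occ O →
              ∀ j → FreeSpots u (occ ∪ ⁅ lookup u j ⁆) (O ∪ ⁅ j ⁆)
FreeSpots-∪ {u = u} u↑ {occ} {O} fs j = record { index = index′ ; free = free′ }
  where
  open FreeSpots fs

  index′ : ∀ {s} → s ∉ occ ∪ ⁅ lookup u j ⁆ → ∃ λ i → lookup u i ≡ s × i ∉ O ∪ ⁅ j ⁆
  index′ s∉ with ∉-∪⁅⁆⁻ s∉
  ... | s∉occ , s≢ with index s∉occ
  ...   | i , refl , i∉O = i , refl , ∉-∪⁅⁆⁺ i∉O (s≢ ∘ cong (lookup u))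

  free′ : ∀ {i} → i ∉ O ∪ ⁅ j ⁆ → lookup u i ∉ occ ∪ ⁅ lookup u j ⁆
  free′ i∉ with ∉-∪⁅⁆⁻ i∉
  ... | i∉O , i≢j = ∉-∪⁅⁆⁺ (free i∉O) (i≢j ∘ lookup-injective u↑)

-- As u is increasing, u_l is at least `i` exactly when l is at or after the block of `i`, and u
-- maps the least free such l to the least free spot. Without a block, no entry of u reaches `i`,
-- and every free spot is an entry of u.
firstAvailable-block : {u : Vec (Fin n) k} → Increasing u → ∀ {occ O} →
  FreeSpots u occ O → ∀ i →
  firstAvailable occ i ≡
  Maybe.map (lookup u) (block (Vec.map number u) (toℕ i) >>= firstAvailable O)
firstAvailable-block {u = u} u↑ {occ} {O} fs i =
  isLeast-unique (isLeast-firstAvailable occ i) (go (isLeast-least _))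
  where
  open FreeSpots fs

  -- This says that `number i` is at most u_j, so `i` is in block `j` or an earlier one; the least
  -- such `j` is the block of `i`.
  InBlock : Pred (Fin _) 0ℓ
  InBlock j = toℕ i < lookup (Vec.map number u) j

  ≤-lookup⇒ : ∀ {j} → i ≤ᶠ lookup u j → InBlock j
  ≤-lookup⇒ {j} i≤ = subst (toℕ i <_) (sym (lookup-map j number u)) (s≤s i≤)

  ⇒≤-lookup : ∀ {j} → InBlock j → i ≤ᶠ lookup u j
  ⇒≤-lookup {j} i< = s≤s⁻¹ (subst (toℕ i <_) (lookup-map j number u) i<)

  park : ∀ {j} → InBlock j → (∀ l → InBlock l → j ≤ᶠ l) →
         ∀ {r} → IsLeast (Available O j) r →
         IsLeast (Available occ i) (Maybe.map (lookup u) r)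
  park i≤uⱼ j≤ (none ¬a) = none λ s (i≤s , s∉occ) →
    let l , uₗ≡s , l∉O = index s∉occ
    in ¬a l (j≤ l (≤-lookup⇒ (subst (i ≤ᶠ_) (sym uₗ≡s) i≤s)) , l∉O)
  park i≤uⱼ j≤ (some (j≤j′ , j′∉O) j′≤) = some
    (≤-trans (⇒≤-lookup i≤uⱼ) (lookup-mono-≤ u↑ j≤j′) , free j′∉O)
    λ s (i≤s , s∉occ) →
    let l , uₗ≡s , l∉O = index s∉occ
    in subst (_ ≤ᶠ_) uₗ≡s (lookup-mono-≤ u↑
         (j′≤ l (j≤ l (≤-lookup⇒ (subst (i ≤ᶠ_) (sym uₗ≡s) i≤s)) , l∉O)))

  go : ∀ {b} → IsLeast InBlock b →
       IsLeast (Available occ i) (Maybe.map (lookup u) (b >>= firstAvailable O))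
  go (none ¬b)     = none λ s (i≤s , s∉occ) →
    let l , uₗ≡s , _ = index s∉occ
    in ¬b l (≤-lookup⇒ (subst (i ≤ᶠ_) (sym uₗ≡s) i≤s))
  go (some {j} i≤uⱼ j≤) = park i≤uⱼ j≤ (isLeast-firstAvailable O j)

-- Induction on the number of cars. First cars from one block park alike and preserve the invariant,
-- so they contribute equally; collecting them by blocks makes the block lengths the variables. The
-- occupied sets vary freely, since each car changes both.
parkingWeight-differences : {u : Vec (Fin n) k} → Increasing u →
  (l : ℕ) → ∀ {occ O} → FreeSpots u occ O →
  parkingWeight (replicate n 1) occ l ≡ parkingWeight (differences u) O l
parkingWeight-differences u↑ zero    fs = refl
parkingWeight-differences {n} {k} {u} u↑ (suc l) {occ} {O} fs = begin
  parkingWeight ones occ (suc l)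
    ≡⟨ parkingWeight-suc ones occ l ⟩
  sum (tabulate λ i → lookup ones i * afterFirst ones occ l (firstAvailable occ i))
    ≡⟨ cong sum (tabulate-cong car) ⟩
  sum (tabulate {n = n} (G ∘ block v ∘ toℕ))
    ≡⟨ cong sum (tabulate-toℕ (G ∘ block v) n) ⟩
  sumBelow (G ∘ block v) n
    -- Starting at p = 0 leaves an empty sum in front. The first `refl` records that a car
    -- preferring a number above u_k fails and contributes 0.
    ≡⟨ sumBelow-blocks (G ∘ block v) G refl v (Linked.map⁺ (Linked.map s≤s u↑))
         (All.universal (λ _ → z≤n) v) (All.map⁺ (All.universal Fin.toℕ<n u)) z≤n
         (λ _ _ _ → refl) ⟩
  sum (tabulate λ j → lookup x j * G (just j))
    ≡⟨ parkingWeight-suc x O l ⟨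
  parkingWeight x O (suc l) ∎
  where
  open ≡-Reasoning
  ones = replicate n 1
  x = differences u
  v = Vec.map number u

  G : Maybe (Fin k) → ℕ
  G b = afterFirst x O l (b >>= firstAvailable O)

  simulate : ∀ r → afterFirst ones occ l (Maybe.map (lookup u) r) ≡ afterFirst x O l r
  simulate (just j) = parkingWeight-differences u↑ l (FreeSpots-∪ u↑ fs j)
  simulate nothing  = refl

  car : ∀ i → lookup ones i * afterFirst ones occ l (firstAvailable occ i) ≡
              G (block v (toℕ i))
  car i = begin
    lookup ones i * afterFirst ones occ l (firstAvailable occ i)
      ≡⟨ cong (_* afterFirst ones occ l (firstAvailable occ i)) (lookup-replicate i 1) ⟩
    1 * afterFirst ones occ l (firstAvailable occ i)
      ≡⟨ *-identityˡ _ ⟩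
    afterFirst ones occ l (firstAvailable occ i)
      ≡⟨ cong (afterFirst ones occ l) (firstAvailable-block u↑ fs i) ⟩
    afterFirst ones occ l (Maybe.map (lookup u) (block v (toℕ i) >>= firstAvailable O))
      ≡⟨ simulate (block v (toℕ i) >>= firstAvailable O) ⟩
    G (block v (toℕ i)) ∎

-- The cars t, and the reduction of completions to the free spots.

occupy : Subset n → Vec (Fin n) m → Subset n
occupy O []      = O
occupy O (a ∷ t) = occupy (O ∪ ⁅ a ⁆) t

∉-occupy⁺ : (t : Vec (Fin n) m) {O : Subset n} {s : Fin n} →
            s ∉ O → s ∉ᵛ t → s ∉ occupy O t
∉-occupy⁺ []      s∉O s∉t = s∉O
∉-occupy⁺ (a ∷ t) s∉O s∉t =
  ∉-occupy⁺ t (∉-∪⁅⁆⁺ s∉O (s∉t ∘ here)) (s∉t ∘ there)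

∉-occupy⁻ : (t : Vec (Fin n) m) {O : Subset n} {s : Fin n} →
            s ∉ occupy O t → s ∉ O × s ∉ᵛ t
∉-occupy⁻ []      s∉ = s∉ , λ ()
∉-occupy⁻ (a ∷ t) s∉ with ∉-occupy⁻ t s∉
... | s∉O∪a , s∉t with ∉-∪⁅⁆⁻ s∉O∪a
...   | s∉O , s≢a = s∉O , λ { (here s≡a) → s≢a s≡a ; (there s∈t) → s∉t s∈t }

firstAvailable-∉ : {O : Subset n} {a : Fin n} → a ∉ O → firstAvailable O a ≡ just a
firstAvailable-∉ {O = O} {a} a∉O =
  isLeast-unique (isLeast-firstAvailable O a) (some (≤-refl , a∉O) λ _ → proj₁)

-- Each car of `t` finds its preferred spot free and takes it: later entries are larger than `a`,
-- hence still free once `a` is filled.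
parkAll-occupy : (t : Vec (Fin n) m) → Increasing t → {O : Subset n} → All (_∉ O) t →
                 (c : Vec (Fin n) k) →
                 parkAll O (t Vec.++ c) ≡ parkAll (occupy O t) c
parkAll-occupy []      t↑ []          c = refl
parkAll-occupy (a ∷ t) t↑ (a∉O ∷ t∉O) c rewrite firstAvailable-∉ a∉O =
  parkAll-occupy t (Linked.tail t↑)
    (All.map (λ (b∉O , a<b) → ∉-∪⁅⁆⁺ b∉O (≢-sym (Fin.<⇒≢ a<b)))
      (All.zip (t∉O , Linked-∷⇒All <-trans t↑))) c

parkAll-cast : .(eq : k ≡ l) (O : Subset n) (a : Vec (Fin n) k) →
               parkAll O (cast eq a) ≡ parkAll O a
parkAll-cast {l = zero}  eq O []      = refl
parkAll-cast {l = suc l} eq O (i ∷ a) with firstAvailable O i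
... | just s  = parkAll-cast {l = l} _ (O ∪ ⁅ s ⁆) a
... | nothing = refl

corollary2p8 : (n m : ℕ) → 1 ≤ n → (m≤n : m ≤ n) →
    (t : Vec (Fin n) m) → Increasing t →
    (u : Vec (Fin n) (n ∸ m)) → IncreasingComplement t u →
    length (PC m≤n t) ≡ P (n ∸ m) (differences u)
corollary2p8 n m _ m≤n t t↑ u (u↑ , u⇔∉t) = begin
  length (PC m≤n t)
    ≡⟨ cong length (filter-≐ (parkingCompletion? m≤n t) (parks? (occupy ⊥ t))
         ((λ {c} → subst Is-just (park-t c)) , λ {c} → subst Is-just (sym (park-t c)))
         (words n (n ∸ m))) ⟩
  length (filter (parks? (occupy ⊥ t)) (words n (n ∸ m)))
    ≡⟨ length≡parkingWeight (occupy ⊥ t) (n ∸ m) ⟩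
  parkingWeight (replicate n 1) (occupy ⊥ t) (n ∸ m)
    -- The short street starts empty and has as many spots as there are cars left, which is the
    -- setting of `P`.
    ≡⟨ parkingWeight-differences u↑ (n ∸ m) freeSpots ⟩
  P (n ∸ m) (differences u) ∎
  where
  open ≡-Reasoning

  park-t : (c : Vec (Fin n) (n ∸ m)) →
           parkAll ⊥ (cast (m+[n∸m]≡n m≤n) (t Vec.++ c)) ≡ parkAll (occupy ⊥ t) c
  park-t c = trans (parkAll-cast {l = n} _ ⊥ (t Vec.++ c))
                   (parkAll-occupy t t↑ (All.universal (λ _ → ∉⊥) t) c)

  -- The spots left by t are the entries of u, and every index is free on the empty short street.
  freeSpots : FreeSpots u (occupy ⊥ t) ⊥
  freeSpots = record
    { index = λ {s} s∉ →
        let s∈u = Equivalence.from (u⇔∉t s) (proj₂ (∉-occupy⁻ t s∉))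
        in Anyᵛ.index s∈u , sym (lookup-index s∈u) , ∉⊥
    ; free  = λ {j} _ →
        ∉-occupy⁺ t ∉⊥ (Equivalence.to (u⇔∉t (lookup u j)) (∈-lookup j u))
    }
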